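{- Let $\mathcal U=[-\underline{\zeta},\overline{\zeta}]$ be an uncertainty set that is the same in every round, where $\underline{\zeta},\overline{\zeta}>0$ are polynomials in the number of rounds $\tau$. Let the payoff function $g$ be monotonically non-decreasing with $g(0)=0$ and Lipschitz continuous with constant $L$, i.e. $|g(y)-g(x)|\le L|y-x|$ for all real $x,y$. Let $S_0$ be the initial price, let $g_0(S_0)$ be the exact European price upper bound, and let $\hat g_0(S_0)$ be its multinomial tree approximation with discretization parameter $\epsilon$ (both defined in the context). Then the approximation error satisfies $$0\le g_0(S_0)-\hat g_0(S_0)\le C_1\sqrt{\epsilon}\,L\,\tau\,S_0$$ for some constant $C_1$.
   Context: Exact value functions: $g_\tau(x)=g(x)$ and, for $t=\tau-1,\dots,0$, $$g_t(x)=\min_{\Delta}\max_{R\in\mathcal U}\bigl[g_{t+1}(x(1+R))-R\Delta\bigr].$$ The number $g_0(S_0)$ is the no-arbitrage upper bound of the price of the European option with payoff $g$ in the $\tau$-round hedging game with initial price $S_0$ and uncertainty set $\mathcal U$ for the return in each round. Multinomial tree approximation: the set $\mathcal U$ is replaced by the discrete set $\hat{\mathcal U}=\{ -\underline{\zeta},-\underline{\zeta}+\epsilon,-\underline{\zeta}+2\epsilon,\dots,\overline{\zeta}\}$, where $\epsilon$ is a parameter of the algorithm. Put $\hat g_\tau(x)=g(x)$ and, for $t=\tau-1,\dots,0$, let $\hat g_t(x)$ be the optimal value of the linear program in the variables $p,\Delta$: minimize $p$ subject to $\hat g_{t+1}(x(1+r))-r\Delta\le p$ for all $r\in\hat{\mathcal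 U}$.
   Formalization: C_1 is an absolute constant when the lower bound ζ(τ) is at most 1 (prices stay nonnegative); beyond that, where a C_1 independent of τ fails in general, C_1 may depend on both ζ's and on τ. -}

module Defs where

open import Algebra.Bundles using (CommutativeRing)
open import Algebra.Structures using (IsCommutativeRing)
import Algebra.Construct.NaturalChoice.Max as Max
import Algebra.Definitions.RawMonoid as RawMonoidDefs
open import Data.List.Base using (List; foldr)
open import Data.Nat.Base as ℕ using (ℕ; suc)
open import Data.Product.Base using (∃; ∃-syntax; _×_)
open import Data.Sum.Base using (_⊎_)
open import Data.Unit.Base using (⊤)
open import Level using (0ℓ)
open import Relation.Binary.Bundles using (TotalOrder)
import Relation.Binary.Construct.NonStrictToStrict as ToStrict
open import Relation.Binary.Core using (Rel)
open import Relation.Binary.Structures using (IsDecTotalOrder)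
open import Relation.Binary.PropositionalEquality.Core using (_≡_; _≢_)
open import Relation.Unary using (Pred)

module _ {A : Set} (_≤_ : Rel A 0ℓ) where

  IsGreatest IsLeast UpperBound IsSupremum : Pred A 0ℓ → Pred A 0ℓ
  IsGreatest S m = S m × (∀ y → S y → y ≤ m)
  IsLeast    S m = S m × (∀ y → S y → m ≤ y)
  UpperBound S b = ∀ y → S y → y ≤ b
  IsSupremum S   = IsLeast (UpperBound S)

Image : {A B : Set} → Pred A 0ℓ → (A → B) → Pred B 0ℓ
Image S f y = ∃[ x ] S x × f x ≡ y

-- The classical axioms of the real numbers, which determine them up to
-- isomorphism.  The order is decidable because the reals are meant classically.
record CompleteOrderedField : Set₁ where
  infix  4 _≤_
  infixl 6 _+_
  infixl 7 _*_
  infix  8 -_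
  field
    ℝ                 : Set
    _+_ _*_           : ℝ → ℝ → ℝ
    -_                : ℝ → ℝ
    0# 1#             : ℝ
    _≤_               : Rel ℝ 0ℓ
    isCommutativeRing : IsCommutativeRing _≡_ _+_ _*_ -_ 0# 1#
    0≢1               : 0# ≢ 1#
    inverse           : ∀ x → x ≢ 0# → ∃[ y ] x * y ≡ 1#
    isDecTotalOrder   : IsDecTotalOrder _≡_ _≤_
    +-monoˡ-≤         : ∀ z {x y} → x ≤ y → x + z ≤ y + z
    *-nonNeg          : ∀ {x y} → 0# ≤ x → 0# ≤ y → 0# ≤ x * y
    complete          : (S : Pred ℝ 0ℓ) → ∃ S → ∃ (UpperBound _≤_ S) →
                        ∃ (IsSupremum _≤_ S)

  commutativeRing : CommutativeRing 0ℓ 0ℓ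
  commutativeRing = record { isCommutativeRing = isCommutativeRing }

  open CommutativeRing commutativeRing public using (_-_; +-rawMonoid)

  totalOrder : TotalOrder 0ℓ 0ℓ 0ℓ
  totalOrder = record
    { isTotalOrder = IsDecTotalOrder.isTotalOrder isDecTotalOrder }

  open ToStrict _≡_ _≤_ public using (_<_)
  open Max totalOrder public using (_⊔_)
  open RawMonoidDefs +-rawMonoid public using () renaming (_×_ to infixr 8 _·_)

  ∣_∣ : ℝ → ℝ
  ∣ x ∣ = x ⊔ (- x)

  fromℕ : ℕ → ℝ
  fromℕ n = n · 1#

  IsSqrt : ℝ → ℝ → Set
  IsSqrt x s = 0# ≤ s × s * s ≡ x

  -- Real polynomials are coefficient lists, constant term first.
  evalPoly : List ℝ → ℝ → ℝ
  evalPoly as x = foldr (λ a v → a + x * v) 0# as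

module Hedging (𝓡 : CompleteOrderedField) where
  open CompleteOrderedField 𝓡

  Monotone : (ℝ → ℝ) → Set
  Monotone g = ∀ {x y} → x ≤ y → g x ≤ g y

  Lipschitz : ℝ → (ℝ → ℝ) → Set
  Lipschitz L g = ∀ x y → ∣ g y - g x ∣ ≤ L * ∣ y - x ∣

  Interval : ℝ → ℝ → Pred ℝ 0ℓ
  Interval ζ̲ ζ̄ R = - ζ̲ ≤ R × R ≤ ζ̄

  -- The last step, the one ending in ζ̄, is shorter than ε
  -- when ε does not divide ζ̲ + ζ̄.
  Grid : ℝ → ℝ → ℝ → Pred ℝ 0ℓ
  Grid ζ̲ ζ̄ ε r = (∃[ j ] r ≡ - ζ̲ + j · ε × r ≤ ζ̄) ⊎ r ≡ ζ̄

  -- The hedger's loss when the return is R, the price moves from x to x(1+R),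
  -- and f is the value function of the next round.
  loss : (ℝ → ℝ) → ℝ → ℝ → ℝ → ℝ
  loss f x Δ R = f (x * (1# + R)) - R * Δ

  -- v = min_Δ max_{R ∈ U} F Δ R, where worst Δ is the inner maximum.
  record IsMinMax (U : Pred ℝ 0ℓ) (F : ℝ → ℝ → ℝ) (v : ℝ) : Set where
    field
      worst     : ℝ → ℝ
      worst-max : ∀ Δ → IsGreatest _≤_ (Image U (F Δ)) (worst Δ)
      value-min : IsLeast _≤_ (Image (λ _ → ⊤) worst) v

  IsLPValue : Pred ℝ 0ℓ → (ℝ → ℝ → ℝ) → ℝ → Set
  IsLPValue U F = IsLeast _≤_ (λ p → ∃[ Δ ] (∀ r → U r → F Δ r ≤ p))

  -- Value functions are indexed by the round t; those at t > τ are irrelevant.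
  record IsExactValue (U : Pred ℝ 0ℓ) (τ : ℕ) (g : ℝ → ℝ)
                      (v : ℕ → ℝ → ℝ) : Set where
    field
      terminal : ∀ x → v τ x ≡ g x
      backward : ∀ t → t ℕ.< τ → ∀ x →
                 IsMinMax U (loss (v (suc t)) x) (v t x)

  record IsTreeValue (Û : Pred ℝ 0ℓ) (τ : ℕ) (g : ℝ → ℝ)
                     (v̂ : ℕ → ℝ → ℝ) : Set where
    field
      terminal : ∀ x → v̂ τ x ≡ g x
      backward : ∀ t → t ℕ.< τ → ∀ x →
                 IsLPValue Û (loss (v̂ (suc t)) x) (v̂ t x)

  ErrorBound : ℝ → ℝ → ℝ → ℕ → Set
  ErrorBound C₁ ζ̲ ζ̄ τ =
    ∀ (g : ℝ → ℝ) (L S₀ ε √ε : ℝ) (v v̂ : ℕ → ℝ → ℝ) →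
    Monotone g → g 0# ≡ 0# → Lipschitz L g →
    0# ≤ S₀ → 0# < ε → IsSqrt ε √ε →
    IsExactValue (Interval ζ̲ ζ̄) τ g v →
    IsTreeValue (Grid ζ̲ ζ̄ ε) τ g v̂ →
    0# ≤ v 0 S₀ - v̂ 0 S₀ ×
    v 0 S₀ - v̂ 0 S₀ ≤ C₁ * √ε * L * fromℕ τ * S₀

{-# OPTIONS --safe #-}
module Submission where

-- By its definition as a minimum over positions, g_t(x) is the least p for which some
-- position Δ hedges g_{t+1} at cost p, and likewise on the grid; so it suffices to turn
-- hedges for one problem into hedges for another.  If the function to be hedged grows by
-- at most B ∣ 1 + R ∣ with ∣ 1 + R ∣ ≤ M + R, then holding B more units costs only B M more.
-- This propagates Lipschitz constants, a priori bounds and the accumulated error backwards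
-- with a factor M per round, and M = 1 is possible when ζ̲ ≤ 1.  A hedge on the grid is a
-- hedge on the interval up to the variation of the Lipschitz function g_{t+1} over one grid
-- step, which is linear in ε.

open import Defs
open import Algebra.Bundles using (CommutativeRing)
import Algebra.Construct.NaturalChoice.Max
import Algebra.Properties.Ring
import Algebra.Properties.Semiring.Exp
import Algebra.Properties.Semiring.Mult.TCOptimised
import Algebra.Solver.Ring
open import Algebra.Solver.Ring.AlmostCommutativeRing using (fromCommutativeRing; _-Raw-AlmostCommutative⟶_)
open import Data.Integer.Base as ℤ using (ℤ; +_; -[1+_])
import Data.Integer.Properties as ℤ
open import Data.List.Base using (List)
open import Data.Maybe.Base using (Maybe; map)
open import Data.Nat.Base as ℕ using (ℕ; suc; zero)
import Data.Nat.Properties as ℕ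
open import Data.Product.Base using (∃-syntax; _×_; _,_; proj₁; proj₂)
open import Data.Sum.Base using (inj₁; inj₂)
open import Data.Unit.Base using (tt)
open import Level using (0ℓ)
open import Relation.Binary.PropositionalEquality.Core using (_≡_; refl; cong; cong₂; subst; subst₂; sym; trans)
import Relation.Binary.Reasoning.Setoid
open import Relation.Binary.Structures using (IsDecTotalOrder)
open import Relation.Nullary.Decidable.Core using (dec⇒maybe; decidable-stable; yes; no)
open import Relation.Nullary.Negation.Core using (¬_; contradiction)
open import Relation.Unary using (Pred)

-- Ring identities with integer coefficients over a commutative ring.

module IntegerCoefficients {c ℓ} (R : CommutativeRing c ℓ) where
  open CommutativeRing R
    using ( Carrier; _≈_; _+_; _*_; -_; _-_; 0#; 1#; reflexive; setoid; semiring; ring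
          ; +-identityˡ; +-identityʳ; +-assoc; +-comm; +-cong; +-congˡ; +-congʳ; -‿cong
          ; *-comm; *-congʳ )
    renaming (refl to ≈-refl; sym to ≈-sym; trans to ≈-trans)
  open Algebra.Properties.Ring ring
  open Algebra.Properties.Semiring.Mult.TCOptimised semiring renaming (_×_ to infixl 8 _·_)
  open Relation.Binary.Reasoning.Setoid setoid

  ⟦_⟧ : ℤ → Carrier
  ⟦ + n ⟧      = n · 1#
  ⟦ -[1+ n ] ⟧ = - (suc n · 1#)

  ⟦⟧-homo-neg : ∀ i → ⟦ ℤ.- i ⟧ ≈ - ⟦ i ⟧
  ⟦⟧-homo-neg (+ zero)  = ≈-sym -0#≈0#
  ⟦⟧-homo-neg (+ suc n) = ≈-refl
  ⟦⟧-homo-neg -[1+ n ]  = ≈-sym (-‿involutive _)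

  ⟦⟧-homo-⊖ : ∀ m n → ⟦ m ℤ.⊖ n ⟧ ≈ m · 1# - n · 1#
  ⟦⟧-homo-⊖ m zero = begin
    m · 1#       ≈⟨ +-identityʳ _ ⟨
    m · 1# + 0#  ≈⟨ +-congˡ -0#≈0# ⟨
    m · 1# - 0#  ∎
  ⟦⟧-homo-⊖ zero (suc n) = ≈-sym (+-identityˡ _)
  ⟦⟧-homo-⊖ (suc m) (suc n) = begin
    ⟦ suc m ℤ.⊖ suc n ⟧                ≡⟨ cong ⟦_⟧ (ℤ.[1+m]⊖[1+n]≡m⊖n m n) ⟩
    ⟦ m ℤ.⊖ n ⟧                        ≈⟨ ⟦⟧-homo-⊖ m n ⟩
    m · 1# - n · 1#                    ≈⟨ +-congʳ (xyx⁻¹≈y 1# _) ⟨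
    1# + m · 1# - 1# - n · 1#          ≈⟨ +-assoc _ _ _ ⟩
    1# + m · 1# + (- 1# - n · 1#)      ≈⟨ +-congˡ (-‿+-comm _ _) ⟩
    1# + m · 1# - (1# + n · 1#)        ≈⟨ +-cong (×-homo-+ 1# 1 m) (-‿cong (×-homo-+ 1# 1 n)) ⟨
    suc m · 1# - suc n · 1#            ∎

  ⟦⟧-homo-+ : ∀ i j → ⟦ i ℤ.+ j ⟧ ≈ ⟦ i ⟧ + ⟦ j ⟧
  ⟦⟧-homo-+ (+ m)    (+ n)    = ×-homo-+ 1# m n
  ⟦⟧-homo-+ (+ m)    -[1+ n ] = ⟦⟧-homo-⊖ m (suc n)
  ⟦⟧-homo-+ -[1+ m ] (+ n)    = ≈-trans (⟦⟧-homo-⊖ n (suc m)) (+-comm _ _)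
  ⟦⟧-homo-+ -[1+ m ] -[1+ n ] = begin
    - (suc (suc (m ℕ.+ n)) · 1#)   ≡⟨ cong (λ k → - (suc k · 1#)) (ℕ.+-suc m n) ⟨
    - ((suc m ℕ.+ suc n) · 1#)     ≈⟨ -‿cong (×-homo-+ 1# (suc m) (suc n)) ⟩
    - (suc m · 1# + suc n · 1#)    ≈⟨ -‿+-comm _ _ ⟨
    - (suc m · 1#) - suc n · 1#    ∎

  -- Multiplicativity is known for two nonnegative integers from multiples of `1#`; negating one
  -- factor at a time, with commutativity to change sides, reaches the other sign patterns.
  ⟦⟧-homo-*-neg : ∀ i j → ⟦ i ℤ.* j ⟧ ≈ ⟦ i ⟧ * ⟦ j ⟧ → ⟦ ℤ.- i ℤ.* j ⟧ ≈ ⟦ ℤ.- i ⟧ * ⟦ j ⟧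
  ⟦⟧-homo-*-neg i j eq = begin
    ⟦ ℤ.- i ℤ.* j ⟧    ≡⟨ cong ⟦_⟧ (ℤ.neg-distribˡ-* i j) ⟨
    ⟦ ℤ.- (i ℤ.* j) ⟧  ≈⟨ ⟦⟧-homo-neg (i ℤ.* j) ⟩
    - ⟦ i ℤ.* j ⟧      ≈⟨ -‿cong eq ⟩
    - (⟦ i ⟧ * ⟦ j ⟧)  ≈⟨ -‿distribˡ-* _ _ ⟩
    - ⟦ i ⟧ * ⟦ j ⟧    ≈⟨ *-congʳ (⟦⟧-homo-neg i) ⟨
    ⟦ ℤ.- i ⟧ * ⟦ j ⟧  ∎

  ⟦⟧-homo-*-swap : ∀ i j → ⟦ i ℤ.* j ⟧ ≈ ⟦ i ⟧ * ⟦ j ⟧ → ⟦ j ℤ.* i ⟧ ≈ ⟦ j ⟧ * ⟦ i ⟧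
  ⟦⟧-homo-*-swap i j eq = ≈-trans (reflexive (cong ⟦_⟧ (ℤ.*-comm j i))) (≈-trans eq (*-comm _ _))

  ⟦⟧-homo-+*+ : ∀ m n → ⟦ + m ℤ.* + n ⟧ ≈ ⟦ + m ⟧ * ⟦ + n ⟧
  ⟦⟧-homo-+*+ m n = ≈-trans (reflexive (cong ⟦_⟧ (sym (ℤ.pos-* m n)))) (×1-homo-* m n)

  ⟦⟧-homo-*-+ : ∀ i n → ⟦ i ℤ.* + n ⟧ ≈ ⟦ i ⟧ * ⟦ + n ⟧
  ⟦⟧-homo-*-+ (+ m)    n = ⟦⟧-homo-+*+ m n
  ⟦⟧-homo-*-+ -[1+ m ] n = ⟦⟧-homo-*-neg (+ suc m) (+ n) (⟦⟧-homo-+*+ (suc m) n)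

  ⟦⟧-homo-* : ∀ i j → ⟦ i ℤ.* j ⟧ ≈ ⟦ i ⟧ * ⟦ j ⟧
  ⟦⟧-homo-* i (+ n)    = ⟦⟧-homo-*-+ i n
  ⟦⟧-homo-* i -[1+ n ] = ⟦⟧-homo-*-swap -[1+ n ] i
    (⟦⟧-homo-*-neg (+ suc n) i (⟦⟧-homo-*-swap i (+ suc n) (⟦⟧-homo-*-+ i (suc n))))

  morphism : ℤ.+-*-rawRing -Raw-AlmostCommutative⟶ fromCommutativeRing R
  morphism = record
    { ⟦_⟧    = ⟦_⟧
    ; +-homo = ⟦⟧-homo-+
    ; *-homo = ⟦⟧-homo-*
    ; -‿homo = ⟦⟧-homo-neg
    ; 0-homo = ≈-refl
    ; 1-homo = ≈-refl
    }

  -- Only a semi-decision: distinct integers may have equal images in a ring of positive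
  -- characteristic.
  _coeff≟_ : ∀ i j → Maybe (⟦ i ⟧ ≈ ⟦ j ⟧)
  i coeff≟ j = map (λ i≡j → reflexive (cong ⟦_⟧ i≡j)) (dec⇒maybe (i ℤ.≟ j))

  open Algebra.Solver.Ring ℤ.+-*-rawRing (fromCommutativeRing R) morphism _coeff≟_ public
    using (solve; _:=_; _:+_; _:*_; _:-_; :-_; con)

-- Ordered field arithmetic and the Archimedean property.

module OrderedField (𝓡 : CompleteOrderedField) where
  open CompleteOrderedField 𝓡
  private module Max = Algebra.Construct.NaturalChoice.Max totalOrder
  open CommutativeRing commutativeRing public using (*-identityˡ; semiring)
  open IsDecTotalOrder isDecTotalOrder public using (_≤?_; total; antisym)
    renaming (refl to ≤-refl; trans to ≤-trans; reflexive to ≤-reflexive)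
  open IntegerCoefficients commutativeRing public
    using (solve; _:=_; _:+_; _:*_; _:-_; :-_; con)
  open Algebra.Properties.Semiring.Exp semiring public using (_^_)

  x≤y⇒0≤y-x : ∀ {x y} → x ≤ y → 0# ≤ y - x
  x≤y⇒0≤y-x {x} {y} x≤y =
    subst (_≤ y - x) (solve 1 (λ x → x :- x := con (+ 0)) refl x) (+-monoˡ-≤ (- x) x≤y)

  -- The standard pattern for inequalities below: `d` is a combination of nonnegative terms built
  -- from the hypotheses, and the ring solver checks that it equals the difference.
  ≤-by : ∀ {x y d} → 0# ≤ d → y - x ≡ d → x ≤ y
  ≤-by {x} {y} 0≤d refl = subst₂ _≤_
    (solve 1 (λ x → con (+ 0) :+ x := x) refl x)
    (solve 2 (λ x y → y :- x :+ x := y) refl x y)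
    (+-monoˡ-≤ x 0≤d)

  ≰⇒≥ : ∀ {x y} → ¬ x ≤ y → y ≤ x
  ≰⇒≥ {x} {y} x≰y with total x y
  ... | inj₁ x≤y = contradiction x≤y x≰y
  ... | inj₂ y≤x = y≤x

  +-nonNeg : ∀ {x y} → 0# ≤ x → 0# ≤ y → 0# ≤ x + y
  +-nonNeg {x} {y} 0≤x 0≤y = ≤-trans 0≤y
    (subst (_≤ x + y) (solve 1 (λ y → con (+ 0) :+ y := y) refl y) (+-monoˡ-≤ y 0≤x))

  *-monoˡ-≤ : ∀ {x y z} → 0# ≤ z → x ≤ y → z * x ≤ z * y
  *-monoˡ-≤ {x} {y} {z} 0≤z x≤y = ≤-by (*-nonNeg 0≤z (x≤y⇒0≤y-x x≤y))
    (solve 3 (λ x y z → z :* y :- z :* x := z :* (y :- x)) refl x y z)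

  0≤1 : 0# ≤ 1#
  0≤1 with total 0# 1#
  ... | inj₁ 0≤1 = 0≤1
  -- If `1# ≤ 0#`, then `0# - 1#` is nonnegative, and its square is `1#`.
  ... | inj₂ 1≤0 = subst (0# ≤_)
    (solve 0 ((con (+ 0) :- con (+ 1)) :* (con (+ 0) :- con (+ 1)) := con (+ 1)) refl)
    (*-nonNeg (x≤y⇒0≤y-x 1≤0) (x≤y⇒0≤y-x 1≤0))

  x≤∣x∣ : ∀ x → x ≤ ∣ x ∣
  x≤∣x∣ x = Max.x≤x⊔y x (- x)

  -x≤∣x∣ : ∀ x → - x ≤ ∣ x ∣
  -x≤∣x∣ x = Max.x≤y⊔x x (- x)

  ∣∣-lub : ∀ {x y} → x ≤ y → - x ≤ y → ∣ x ∣ ≤ y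
  ∣∣-lub = Max.⊔-lub

  0≤∣x∣ : ∀ x → 0# ≤ ∣ x ∣
  0≤∣x∣ x with total 0# x
  ... | inj₁ 0≤x = ≤-trans 0≤x (x≤∣x∣ x)
  ... | inj₂ x≤0 = ≤-trans
    (subst (0# ≤_) (solve 1 (λ x → con (+ 0) :- x := :- x) refl x) (x≤y⇒0≤y-x x≤0)) (-x≤∣x∣ x)

  0≤x⇒∣x∣≤x : ∀ {x} → 0# ≤ x → ∣ x ∣ ≤ x
  0≤x⇒∣x∣≤x {x} 0≤x = ∣∣-lub ≤-refl
    (≤-by (+-nonNeg 0≤x 0≤x) (solve 1 (λ x → x :- (:- x) := x :+ x) refl x))

  x*y≤∣x∣*∣y∣ : ∀ x y → x * y ≤ ∣ x ∣ * ∣ y ∣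
  x*y≤∣x∣*∣y∣ x y with total 0# x
  ... | inj₁ 0≤x = ≤-by
    (+-nonNeg (*-nonNeg 0≤x (x≤y⇒0≤y-x (x≤∣x∣ y))) (*-nonNeg (x≤y⇒0≤y-x (x≤∣x∣ x)) (0≤∣x∣ y)))
    (solve 4 (λ x y ∣x∣ ∣y∣ → ∣x∣ :* ∣y∣ :- x :* y := x :* (∣y∣ :- y) :+ (∣x∣ :- x) :* ∣y∣)
      refl x y (∣ x ∣) (∣ y ∣))
  ... | inj₂ x≤0 = ≤-by
    (+-nonNeg (*-nonNeg (x≤y⇒0≤y-x x≤0) (x≤y⇒0≤y-x (-x≤∣x∣ y)))
              (*-nonNeg (x≤y⇒0≤y-x (-x≤∣x∣ x)) (0≤∣x∣ y)))
    (solve 4 (λ x y ∣x∣ ∣y∣ → ∣x∣ :* ∣y∣ :- x :* y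
                := (con (+ 0) :- x) :* (∣y∣ :- (:- y)) :+ (∣x∣ :- (:- x)) :* ∣y∣)
      refl x y (∣ x ∣) (∣ y ∣))

  ∣-x∣≡∣x∣ : ∀ x → ∣ - x ∣ ≡ ∣ x ∣
  ∣-x∣≡∣x∣ x = trans (cong (- x ⊔_) (solve 1 (λ x → :- (:- x) := x) refl x)) (Max.⊔-comm (- x) x)

  ∣x*y∣≤∣x∣*∣y∣ : ∀ x y → ∣ x * y ∣ ≤ ∣ x ∣ * ∣ y ∣
  ∣x*y∣≤∣x∣*∣y∣ x y = ∣∣-lub (x*y≤∣x∣*∣y∣ x y)
    (subst₂ _≤_ (solve 2 (λ x y → x :* (:- y) := :- (x :* y)) refl x y)
      (cong (∣ x ∣ *_) (∣-x∣≡∣x∣ y)) (x*y≤∣x∣*∣y∣ x (- y)))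

  fromℕ-nonNeg : ∀ n → 0# ≤ fromℕ n
  fromℕ-nonNeg zero    = ≤-refl
  fromℕ-nonNeg (suc n) = +-nonNeg 0≤1 (fromℕ-nonNeg n)

  ^-nonNeg : ∀ {x} → 0# ≤ x → ∀ n → 0# ≤ x ^ n
  ^-nonNeg 0≤x zero    = 0≤1
  ^-nonNeg 0≤x (suc n) = *-nonNeg 0≤x (^-nonNeg 0≤x n)

  1^n≡1 : ∀ n → 1# ^ n ≡ 1#
  1^n≡1 zero    = refl
  1^n≡1 (suc n) = trans (*-identityˡ _) (1^n≡1 n)

  -- Negated, because completeness yields no natural number n with y < n · ε: extracting
  -- one would need Markov's principle.
  archimedean : ∀ {ε} → 0# < ε → ∀ y → ¬ (∀ n → n · ε ≤ y)
  archimedean {ε} (0≤ε , 0≢ε) y bounded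
    with complete (λ z → ∃[ n ] z ≡ n · ε) (0# , 0 , refl) (y , λ { _ (n , refl) → bounded n })
  ... | s , upper , least = 0≢ε (antisym 0≤ε
    (≤-by (x≤y⇒0≤y-x s≤s-ε) (solve 2 (λ s ε → con (+ 0) :- ε := s :- ε :- s) refl s ε)))
    where
    s≤s-ε : s ≤ s - ε
    s≤s-ε = least (s - ε) λ { _ (n , refl) → ≤-by (x≤y⇒0≤y-x (upper (suc n · ε) (suc n , refl)))
      (solve 3 (λ s ε nε → s :- ε :- nε := s :- (ε :+ nε)) refl s ε (n · ε)) }

-- Values as least hedging costs, and their comparison.

module ValueFunctions (𝓡 : CompleteOrderedField) where
  open CompleteOrderedField 𝓡
  open Hedging 𝓡
  open OrderedField 𝓡

  -- `IsLPValue U (loss f x) v` unfolds to `v` being the least element of `Feasible U f x`, so its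
  -- two projections are an optimal hedge and a way to bound `v` by any other hedge.
  Feasible : Pred ℝ 0ℓ → (ℝ → ℝ) → ℝ → Pred ℝ 0ℓ
  Feasible U f x p = ∃[ Δ ] (∀ R → U R → loss f x Δ R ≤ p)

  -- The inner maximum is attained in `U`, so `p` dominates all losses of a position exactly when it
  -- dominates `worst Δ`.
  minMax⇒LPValue : ∀ {U F v} → IsMinMax U F v → IsLPValue U F v
  minMax⇒LPValue {U} {F} {v} mm = attained (proj₁ value-min) , least
    where
    open IsMinMax mm
    attained : ∃[ Δ ] (_ × worst Δ ≡ v) → ∃[ Δ ] (∀ R → U R → F Δ R ≤ v)
    attained (Δ , _ , eq) = Δ , λ R u →
      subst (F Δ R ≤_) eq (proj₂ (worst-max Δ) (F Δ R) (R , u , refl))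
    least : ∀ p → ∃[ Δ ] (∀ R → U R → F Δ R ≤ p) → v ≤ p
    least p (Δ , h) with proj₁ (worst-max Δ)
    ... | R , u , eq = ≤-trans (proj₂ value-min (worst Δ) (Δ , tt , refl)) (subst (_≤ p) eq (h R u))

  -- Makes the exact and the approximate problem instances of one notion that differ only in the
  -- return set.
  exact⇒tree : ∀ {U τ g v} → IsExactValue U τ g v → IsTreeValue U τ g v
  exact⇒tree ev = record
    { terminal = terminal
    ; backward = λ t t<τ x → minMax⇒LPValue (backward t t<τ x)
    } where open IsExactValue ev

  -- P t k is a claim about round t when k rounds remain.
  backward-induction : (P : ℕ → ℕ → Set) {τ : ℕ} → P τ 0 →
    (∀ t k → suc t ℕ.+ k ≡ τ → P (suc t) k → P t (suc k)) →
    ∀ k t → t ℕ.+ k ≡ τ → P t k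
  backward-induction P base step zero    t eq =
    subst (λ t → P t 0) (trans (sym eq) (ℕ.+-identityʳ t)) base
  backward-induction P base step (suc k) t eq =
    step t k eq′ (backward-induction P base step k (suc t) eq′)
    where eq′ = trans (sym (ℕ.+-suc t k)) eq

  1+t+k≡τ⇒t<τ : ∀ {t k τ} → suc t ℕ.+ k ≡ τ → t ℕ.< τ
  1+t+k≡τ⇒t<τ {t} eq = ℕ.m+n≤o⇒m≤o (suc t) (ℕ.≤-reflexive eq)

  -- The term B R of the bound is hedged by holding B more units.
  transport-feasible : ∀ {U f h x y B M p} →
    (∀ R → U R → f (y * (1# + R)) ≤ h (x * (1# + R)) + B * (M + R)) →
    Feasible U h x p → Feasible U f y (p + B * M)
  transport-feasible {f = f} {h} {x} {y} {B} {M} {p} f≤h (Δ , hedged) = Δ + B , λ R u →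
    ≤-by (+-nonNeg (x≤y⇒0≤y-x (hedged R u)) (x≤y⇒0≤y-x (f≤h R u)))
      (solve 7 (λ p F H R Δ B M → (p :+ B :* M) :- (F :- R :* (Δ :+ B))
                  := (p :- (H :- R :* Δ)) :+ ((H :+ B :* (M :+ R)) :- F))
        refl p (f (y * (1# + R))) (h (x * (1# + R))) R Δ B M)

  -- The factor by which an average price move under a mean-zero return R can expand
  -- distances: the mean of ∣ 1 + R ∣ is at most M.
  Expansion : Pred ℝ 0ℓ → ℝ → Set
  Expansion U M = ∀ R → U R → ∣ 1# + R ∣ ≤ M + R

  -- Instances are `y - x`, for Lipschitz bounds, and each coordinate alone, for a priori bounds.
  HomogeneousForm : (ℝ → ℝ → ℝ) → Set
  HomogeneousForm ℓ = ∀ x y r → ℓ (x * r) (y * r) ≡ ℓ x y * r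

  -- The hedge for `w` at `x`, enlarged by `A * M ^ k * ∣ ℓ x y ∣` units, hedges `v` at `y`: both
  -- prices are multiplied by the same `1# + R`, so homogeneity turns the bound at the next prices
  -- into the present one times `∣ 1# + R ∣`, and `Expansion` applies.
  compare-values : ∀ {U M A τ g h v w} {ℓ : ℝ → ℝ → ℝ} → Expansion U M → 0# ≤ M → 0# ≤ A →
    HomogeneousForm ℓ → IsTreeValue U τ g v → IsTreeValue U τ h w →
    (∀ x y → g y ≤ h x + A * ∣ ℓ x y ∣) →
    ∀ k t → t ℕ.+ k ≡ τ → ∀ x y → v t y ≤ w t x + A * M ^ k * ∣ ℓ x y ∣
  compare-values {U} {M} {A} {τ} {g} {h} {v} {w} {ℓ} expand 0≤M 0≤A homogeneous tv tw g≤h =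
    backward-induction (λ t k → ∀ x y → v t y ≤ w t x + A * M ^ k * ∣ ℓ x y ∣) base step
    where
    module V = IsTreeValue tv
    module W = IsTreeValue tw
    base : ∀ x y → v τ y ≤ w τ x + A * 1# * ∣ ℓ x y ∣
    base x y = subst₂ _≤_ (sym (V.terminal y))
      (cong₂ _+_ (sym (W.terminal x))
        (solve 2 (λ A l → A :* l := A :* con (+ 1) :* l) refl A (∣ ℓ x y ∣)))
      (g≤h x y)
    step : ∀ t k → suc t ℕ.+ k ≡ τ →
      (∀ x y → v (suc t) y ≤ w (suc t) x + A * M ^ k * ∣ ℓ x y ∣) →
      ∀ x y → v t y ≤ w t x + A * M ^ suc k * ∣ ℓ x y ∣
    step t k eq next x y = subst (λ b → v t y ≤ w t x + b)
      (solve 4 (λ A M Mᵏ l → A :* Mᵏ :* l :* M := A :* (M :* Mᵏ) :* l) refl A M (M ^ k) (∣ ℓ x y ∣))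
      (proj₂ (V.backward t t<τ y) _ (transport-feasible {f = v (suc t)} {w (suc t)} {x} {y} dominated
        (proj₁ (W.backward t t<τ x))))
      where
      t<τ = 1+t+k≡τ⇒t<τ eq
      dominated : ∀ R → U R → v (suc t) (y * (1# + R)) ≤
                  w (suc t) (x * (1# + R)) + A * M ^ k * ∣ ℓ x y ∣ * (M + R)
      dominated R u = ≤-by
        (+-nonNeg (x≤y⇒0≤y-x (next (x * (1# + R)) (y * (1# + R))))
          (*-nonNeg (*-nonNeg 0≤A (^-nonNeg 0≤M k)) (x≤y⇒0≤y-x scaled)))
        (solve 7 (λ V W A Mᵏ l l′ m → (W :+ A :* Mᵏ :* l :* m) :- V
                    := (W :+ A :* Mᵏ :* l′ :- V) :+ A :* Mᵏ :* (l :* m :- l′))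
          refl (v (suc t) (y * (1# + R))) (w (suc t) (x * (1# + R))) A (M ^ k)
          (∣ ℓ x y ∣) (∣ ℓ (x * (1# + R)) (y * (1# + R)) ∣) (M + R))
        where
        scaled : ∣ ℓ (x * (1# + R)) (y * (1# + R)) ∣ ≤ ∣ ℓ x y ∣ * (M + R)
        scaled = subst (λ l → ∣ l ∣ ≤ ∣ ℓ x y ∣ * (M + R)) (sym (homogeneous x y (1# + R)))
          (≤-trans (∣x*y∣≤∣x∣*∣y∣ _ _) (*-monoˡ-≤ (0≤∣x∣ _) (expand R u)))

  -- Absence of arbitrage: any position loses or breaks even at one of the returns `a ≤ 0# ≤ b`, so
  -- no negative cost is feasible. Comparison with this value yields the a priori bounds.
  zero-treeValue : ∀ {U a b τ} → U a → a ≤ 0# → U b → 0# ≤ b →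
    IsTreeValue U τ (λ _ → 0#) (λ _ _ → 0#)
  zero-treeValue {U} {a} {b} ua a≤0 ub 0≤b = record
    { terminal = λ _ → refl
    ; backward = λ t _ x → (0# , λ R _ → ≤-reflexive
        (solve 1 (λ R → con (+ 0) :- R :* con (+ 0) := con (+ 0)) refl R)) , least x
    }
    where
    least : ∀ x p → Feasible U (λ _ → 0#) x p → 0# ≤ p
    least x p (Δ , hedged) with total 0# Δ
    ... | inj₁ 0≤Δ = ≤-by
      (+-nonNeg (x≤y⇒0≤y-x (hedged a ua)) (*-nonNeg (x≤y⇒0≤y-x a≤0) 0≤Δ))
      (solve 3 (λ p r Δ → p :- con (+ 0)
                  := p :- (con (+ 0) :- r :* Δ) :+ (con (+ 0) :- r) :* Δ) refl p a Δ)
    ... | inj₂ Δ≤0 = ≤-by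
      (+-nonNeg (x≤y⇒0≤y-x (hedged b ub)) (*-nonNeg 0≤b (x≤y⇒0≤y-x Δ≤0)))
      (solve 3 (λ p r Δ → p :- con (+ 0)
                  := p :- (con (+ 0) :- r :* Δ) :+ r :* (con (+ 0) :- Δ)) refl p b Δ)

  -- Lipschitz estimates and the expansion factor.

  -- One-sided, to match `compare-values` with both value functions equal; exchanging `x` and `y`
  -- gives the other side.
  LipschitzAbove : ℝ → (ℝ → ℝ) → Set
  LipschitzAbove A f = ∀ x y → f y ≤ f x + A * ∣ y - x ∣

  lipschitz⇒lipschitzAbove : ∀ {L g} → Lipschitz L g → LipschitzAbove L g
  lipschitz⇒lipschitzAbove {L} {g} lip x y =
    ≤-by (x≤y⇒0≤y-x (≤-trans (x≤∣x∣ (g y - g x)) (lip x y)))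
      (solve 3 (λ fx fy d → (fx :+ d) :- fy := d :- (fy :- fx)) refl (g x) (g y) (L * ∣ y - x ∣))

  lipschitz-nonNeg : ∀ {L g} → Lipschitz L g → 0# ≤ L
  lipschitz-nonNeg {L} {g} lip = subst (0# ≤_)
    (trans (cong (L *_) ∣1-0∣≡1) (solve 1 (λ L → L :* con (+ 1) := L) refl L))
    (≤-trans (0≤∣x∣ (g 1# - g 0#)) (lip 0# 1#))
    where
    1-0≡1 : 1# - 0# ≡ 1#
    1-0≡1 = solve 0 (con (+ 1) :- con (+ 0) := con (+ 1)) refl
    ∣1-0∣≡1 : ∣ 1# - 0# ∣ ≡ 1#
    ∣1-0∣≡1 = trans (cong ∣_∣ 1-0≡1) (antisym (0≤x⇒∣x∣≤x 0≤1) (x≤∣x∣ 1#))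

  -- The hypothesis on `r * Δ` makes the linear term favourable, so only `f` is estimated, at prices
  -- differing by `x * (R - r)`.
  loss-near : ∀ {f A x Δ R r ε} → LipschitzAbove A f → 0# ≤ A →
    ∣ R - r ∣ ≤ ε → r * Δ ≤ R * Δ →
    loss f x Δ R ≤ loss f x Δ r + A * ∣ x ∣ * ε
  loss-near {f} {A} {x} {Δ} {R} {r} {ε} lip 0≤A near rΔ≤RΔ = ≤-by
    (+-nonNeg (+-nonNeg (x≤y⇒0≤y-x (lip (x * (1# + r)) (x * (1# + R)))) (x≤y⇒0≤y-x rΔ≤RΔ))
              (*-nonNeg 0≤A (x≤y⇒0≤y-x distance)))
    (solve 8 (λ F G A X ε d RΔ rΔ → (G :- rΔ) :+ A :* X :* ε :- (F :- RΔ)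
                := (G :+ A :* d :- F) :+ (RΔ :- rΔ) :+ A :* (X :* ε :- d))
      refl (f (x * (1# + R))) (f (x * (1# + r))) A (∣ x ∣) ε
      (∣ x * (1# + R) - x * (1# + r) ∣) (R * Δ) (r * Δ))
    where
    distance : ∣ x * (1# + R) - x * (1# + r) ∣ ≤ ∣ x ∣ * ε
    distance = subst (λ d → ∣ d ∣ ≤ ∣ x ∣ * ε)
      (solve 3 (λ x R r → x :* (R :- r) := x :* (con (+ 1) :+ R) :- x :* (con (+ 1) :+ r)) refl x R r)
      (≤-trans (∣x*y∣≤∣x∣*∣y∣ x (R - r)) (*-monoˡ-≤ (0≤∣x∣ x) near))

  -- The two signs of `1# + R` require `1# ≤ M` and `- (R + R) ≤ 1# + M`; the latter is tightest at
  -- `R = - ζ̲`.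
  interval-expansion : ∀ {ζ̲ ζ̄ M} → 1# ≤ M → ζ̲ + ζ̲ ≤ 1# + M → Expansion (Interval ζ̲ ζ̄) M
  interval-expansion {ζ̲} {ζ̄} {M} 1≤M 2ζ̲≤1+M R (-ζ̲≤R , _) = ∣∣-lub
    (≤-by (x≤y⇒0≤y-x 1≤M)
      (solve 2 (λ M R → M :+ R :- (con (+ 1) :+ R) := M :- con (+ 1)) refl M R))
    (≤-by (+-nonNeg (x≤y⇒0≤y-x 2ζ̲≤1+M) (+-nonNeg (x≤y⇒0≤y-x -ζ̲≤R) (x≤y⇒0≤y-x -ζ̲≤R)))
      (solve 3 (λ M R z → M :+ R :- (:- (con (+ 1) :+ R))
                  := (con (+ 1) :+ M :- (z :+ z)) :+ ((R :- (:- z)) :+ (R :- (:- z))))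
        refl M R ζ̲))

  -- Grid points and returns in the interval.

  module _ {ζ̲ ζ̄ : ℝ} (0≤ζ̲ : 0# ≤ ζ̲) (0≤ζ̄ : 0# ≤ ζ̄) where

    -ζ̲≤0 : - ζ̲ ≤ 0#
    -ζ̲≤0 = ≤-by 0≤ζ̲ (solve 1 (λ z → con (+ 0) :- (:- z) := z) refl ζ̲)

    -ζ̲≤ζ̄ : - ζ̲ ≤ ζ̄
    -ζ̲≤ζ̄ = ≤-trans -ζ̲≤0 0≤ζ̄

    module _ {ε : ℝ} (0<ε : 0# < ε) where

      0≤ε : 0# ≤ ε
      0≤ε = proj₁ 0<ε

      -ζ̲≤-ζ̲+jε : ∀ j → - ζ̲ ≤ - ζ̲ + j · ε
      -ζ̲≤-ζ̲+jε j = ≤-by (·-nonNeg j) (solve 2 (λ z e → z :+ e :- z := e) refl (- ζ̲) (j · ε))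
        where
        ·-nonNeg : ∀ j → 0# ≤ j · ε
        ·-nonNeg zero    = ≤-refl
        ·-nonNeg (suc j) = +-nonNeg 0≤ε (·-nonNeg j)

      -ζ̲≡-ζ̲+0 : - ζ̲ ≡ - ζ̲ + 0 · ε
      -ζ̲≡-ζ̲+0 = solve 1 (λ z → z := z :+ con (+ 0)) refl (- ζ̲)

      grid⊆interval : ∀ R → Grid ζ̲ ζ̄ ε R → Interval ζ̲ ζ̄ R
      grid⊆interval _ (inj₁ (j , refl , R≤ζ̄)) = -ζ̲≤-ζ̲+jε j , R≤ζ̄
      grid⊆interval _ (inj₂ refl)             = -ζ̲≤ζ̄ , ≤-refl

      -ζ̲∈grid : Grid ζ̲ ζ̄ ε (- ζ̲)
      -ζ̲∈grid = inj₁ (0 , -ζ̲≡-ζ̲+0 , -ζ̲≤ζ̄)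

      Bracketed : ℝ → Set
      Bracketed R = ∃[ lo ] ∃[ hi ]
        Grid ζ̲ ζ̄ ε lo × Grid ζ̲ ζ̄ ε hi × lo ≤ R × R ≤ hi × hi ≤ lo + ε

      -- Without a bracket, every point `- ζ̲ + n · ε` would stay below `R`, against the Archimedean
      -- property. The double negation is inherited from there and is harmless, since it is used to
      -- prove a decidable inequality.
      ¬¬bracketed : ∀ {R} → Interval ζ̲ ζ̄ R → ¬ ¬ Bracketed R
      ¬¬bracketed {R} (-ζ̲≤R , R≤ζ̄) none = archimedean 0<ε (R + ζ̲) λ n →
        ≤-by (x≤y⇒0≤y-x (below n))
          (solve 3 (λ R z e → R :+ z :- e := R :- (:- z :+ e)) refl R ζ̲ (n · ε))
        where
        next : ∀ n → - ζ̲ + suc n · ε ≡ - ζ̲ + n · ε + ε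
        next n = solve 3 (λ z e ne → z :+ (e :+ ne) := z :+ ne :+ e) refl (- ζ̲) ε (n · ε)
        below : ∀ n → - ζ̲ + n · ε ≤ R
        below zero = subst (_≤ R) -ζ̲≡-ζ̲+0 -ζ̲≤R
        below (suc n) with - ζ̲ + suc n · ε ≤? R | - ζ̲ + suc n · ε ≤? ζ̄
        ... | yes ≤R | _ = ≤R
        ... | no ≰R | yes ≤ζ̄ = contradiction
          ( - ζ̲ + n · ε , - ζ̲ + suc n · ε
          , inj₁ (n , refl , ≤-trans (below n) R≤ζ̄) , inj₁ (suc n , refl , ≤ζ̄)
          , below n , ≰⇒≥ ≰R , ≤-reflexive (next n) ) none
        -- The next regular point lies beyond the interval, so the shorter last step, ending in
        -- `ζ̄`, closes the bracket.
        ... | no ≰R | no ≰ζ̄ = contradiction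
          ( - ζ̲ + n · ε , ζ̄
          , inj₁ (n , refl , ≤-trans (below n) R≤ζ̄) , inj₂ refl
          , below n , R≤ζ̄ , subst (ζ̄ ≤_) (next n) (≰⇒≥ ≰ζ̄) ) none

      -- Rounding R towards the side on which the linear term - R Δ grows costs only the
      -- variation of f over one grid step.
      interpolate-feasible : ∀ {f A x p} → LipschitzAbove A f → 0# ≤ A →
        Feasible (Grid ζ̲ ζ̄ ε) f x p → Feasible (Interval ζ̲ ζ̄) f x (p + A * ∣ x ∣ * ε)
      interpolate-feasible {f} {A} {x} {p} lip 0≤A (Δ , hedged) = Δ , λ R u →
        decidable-stable (_ ≤? _) λ exceeds → ¬¬bracketed u λ bracket → exceeds (bound bracket)
        where
        from-grid : ∀ {R r} → Grid ζ̲ ζ̄ ε r → ∣ R - r ∣ ≤ ε → r * Δ ≤ R * Δ →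
                    loss f x Δ R ≤ p + A * ∣ x ∣ * ε
        from-grid {R} {r} r∈grid near rΔ≤RΔ =
          ≤-trans (loss-near lip 0≤A near rΔ≤RΔ) (+-monoˡ-≤ (A * ∣ x ∣ * ε) (hedged r r∈grid))
        bound : ∀ {R} → Bracketed R → loss f x Δ R ≤ p + A * ∣ x ∣ * ε
        bound {R} (lo , hi , lo∈grid , hi∈grid , lo≤R , R≤hi , hi≤lo+ε) with total 0# Δ
        ... | inj₁ 0≤Δ = from-grid lo∈grid
          (∣∣-lub
            (≤-by (+-nonNeg (x≤y⇒0≤y-x hi≤lo+ε) (x≤y⇒0≤y-x R≤hi))
              (solve 4 (λ R l h e → e :- (R :- l) := (l :+ e :- h) :+ (h :- R)) refl R lo hi ε))
            (≤-by (+-nonNeg 0≤ε (x≤y⇒0≤y-x lo≤R))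
              (solve 3 (λ R l e → e :- (:- (R :- l)) := e :+ (R :- l)) refl R lo ε)))
          (≤-by (*-nonNeg (x≤y⇒0≤y-x lo≤R) 0≤Δ)
            (solve 3 (λ R l D → R :* D :- l :* D := (R :- l) :* D) refl R lo Δ))
        ... | inj₂ Δ≤0 = from-grid hi∈grid
          (∣∣-lub
            (≤-by (+-nonNeg 0≤ε (x≤y⇒0≤y-x R≤hi))
              (solve 3 (λ R h e → e :- (R :- h) := e :+ (h :- R)) refl R hi ε))
            (≤-by (+-nonNeg (x≤y⇒0≤y-x hi≤lo+ε) (x≤y⇒0≤y-x lo≤R))
              (solve 4 (λ R l h e → e :- (:- (R :- h)) := (l :+ e :- h) :+ (R :- l)) refl R lo hi ε)))
          (≤-by (*-nonNeg (x≤y⇒0≤y-x R≤hi) (x≤y⇒0≤y-x Δ≤0))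
            (solve 3 (λ R h D → R :* D :- h :* D := (h :- R) :* (con (+ 0) :- D)) refl R hi Δ))

      -- Exact values against tree values.

      module _ {τ : ℕ} {g : ℝ → ℝ} {v v̂ : ℕ → ℝ → ℝ}
               (tv : IsTreeValue (Interval ζ̲ ζ̄) τ g v) (tv̂ : IsTreeValue (Grid ζ̲ ζ̄ ε) τ g v̂) where

        private
          module V = IsTreeValue tv
          module V̂ = IsTreeValue tv̂

        -- An optimal hedge on the interval also works on the grid, which is a subset, for the
        -- smaller next values.
        tree≤exact : ∀ k t → t ℕ.+ k ≡ τ → ∀ x → v̂ t x ≤ v t x
        tree≤exact = backward-induction (λ t _ → ∀ x → v̂ t x ≤ v t x)
          (λ x → ≤-reflexive (trans (V̂.terminal x) (sym (V.terminal x)))) step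
          where
          step : ∀ t k → suc t ℕ.+ k ≡ τ → (∀ x → v̂ (suc t) x ≤ v (suc t) x) →
                 ∀ x → v̂ t x ≤ v t x
          step t k eq next x with proj₁ (V.backward t (1+t+k≡τ⇒t<τ eq) x)
          ... | Δ , hedged = proj₂ (V̂.backward t (1+t+k≡τ⇒t<τ eq) x) (v t x) (Δ , λ R R∈grid →
            ≤-trans (+-monoˡ-≤ (- (R * Δ)) (next (x * (1# + R)))) (hedged R (grid⊆interval R R∈grid)))

        module _ {M L : ℝ} (1≤M : 1# ≤ M) (expand : Expansion (Interval ζ̲ ζ̄) M)
                 (0≤L : 0# ≤ L) (lip : LipschitzAbove L g) where

          0≤M : 0# ≤ M
          0≤M = ≤-trans 0≤1 1≤M

          -- Comparison of `v` with itself; it prices the rounding of returns in each round.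
          exact-lipschitz : ∀ k t → t ℕ.+ k ≡ τ → LipschitzAbove (L * M ^ k) (v t)
          exact-lipschitz = compare-values expand 0≤M 0≤L
            (solve 3 (λ x y r → y :* r :- x :* r := (y :- x) :* r) refl) tv tv lip

          -- Comparison with the zero payoff. Together with `0≤tree+L∣x∣`, its mirror image on the
          -- grid, it bounds the error independently of `ε`.
          exact≤L∣x∣ : g 0# ≡ 0# → ∀ k t → t ℕ.+ k ≡ τ → ∀ x → v t x ≤ L * M ^ k * ∣ x ∣
          exact≤L∣x∣ g0≡0 k t eq x = subst (v t x ≤_)
            (solve 1 (λ b → con (+ 0) :+ b := b) refl (L * M ^ k * ∣ x ∣))
            (compare-values {ℓ = λ _ y → y} expand 0≤M 0≤L (λ _ _ _ → refl) tv
              (zero-treeValue (≤-refl , -ζ̲≤ζ̄) -ζ̲≤0 (-ζ̲≤ζ̄ , ≤-refl) 0≤ζ̄)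
              (λ _ y → subst₂ (λ g0 d → g y ≤ g0 + L * ∣ d ∣) g0≡0 (y-0≡y y) (lip 0# y)) k t eq x x)
            where
            y-0≡y : ∀ y → y - 0# ≡ y
            y-0≡y = solve 1 (λ y → y :- con (+ 0) := y) refl

          0≤tree+L∣x∣ : g 0# ≡ 0# → ∀ k t → t ℕ.+ k ≡ τ → ∀ x → 0# ≤ v̂ t x + L * M ^ k * ∣ x ∣
          0≤tree+L∣x∣ g0≡0 k t eq x =
            compare-values {ℓ = λ x _ → x} (λ R R∈grid → expand R (grid⊆interval R R∈grid)) 0≤M 0≤L
              (λ _ _ _ → refl)
              (zero-treeValue -ζ̲∈grid -ζ̲≤0 (inj₂ refl) 0≤ζ̄) tv̂
              (λ x _ → subst₂ (λ g0 d → g0 ≤ g x + L * d) g0≡0 (∣0-x∣≡∣x∣ x) (lip x 0#)) k t eq x x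
            where
            ∣0-x∣≡∣x∣ : ∀ x → ∣ 0# - x ∣ ≡ ∣ x ∣
            ∣0-x∣≡∣x∣ x = trans (cong ∣_∣ (solve 1 (λ x → con (+ 0) :- x := :- x) refl x)) (∣-x∣≡∣x∣ x)

          -- The tree hedge is first turned, still on the grid, into a hedge of the exact next
          -- value, and only then extended to the interval, so that the Lipschitz bound is needed
          -- for `v` alone.
          exact≤tree+ε : ∀ k t → t ℕ.+ k ≡ τ → ∀ x →
            v t x ≤ v̂ t x + fromℕ k * (L * M ^ k * ε) * ∣ x ∣
          exact≤tree+ε = backward-induction
            (λ t k → ∀ x → v t x ≤ v̂ t x + fromℕ k * (L * M ^ k * ε) * ∣ x ∣) base step
            where
            base : ∀ x → v τ x ≤ v̂ τ x + 0# * (L * 1# * ε) * ∣ x ∣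
            base x = ≤-reflexive (trans (trans (V.terminal x) (sym (V̂.terminal x)))
              (solve 3 (λ v d l → v := v :+ con (+ 0) :* d :* l) refl (v̂ τ x) (L * 1# * ε) (∣ x ∣)))
            step : ∀ t k → suc t ℕ.+ k ≡ τ →
              (∀ x → v (suc t) x ≤ v̂ (suc t) x + fromℕ k * (L * M ^ k * ε) * ∣ x ∣) →
              ∀ x → v t x ≤ v̂ t x + fromℕ (suc k) * (L * M ^ suc k * ε) * ∣ x ∣
            step t k eq next x = ≤-trans
              (proj₂ (V.backward t t<τ x) _
                (interpolate-feasible (exact-lipschitz k (suc t) eq) 0≤LMᵏ
                  (transport-feasible {f = v (suc t)} {v̂ (suc t)} {x} {x} dominated
                    (proj₁ (V̂.backward t t<τ x)))))
              -- The inherited error, multiplied by `M`, already has the form for `k` rounds with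
              -- `M ^ suc k`; the new rounding cost has only `M ^ k`, and `1≤M` supplies the missing
              -- factor.
              (≤-by (*-nonNeg (*-nonNeg (*-nonNeg 0≤LMᵏ 0≤ε) (0≤∣x∣ x)) (x≤y⇒0≤y-x 1≤M))
                (solve 7 (λ p K L M Mᵏ e X →
                    p :+ (con (+ 1) :+ K) :* (L :* (M :* Mᵏ) :* e) :* X
                      :- (p :+ K :* (L :* Mᵏ :* e) :* X :* M :+ L :* Mᵏ :* X :* e)
                    := L :* Mᵏ :* e :* X :* (M :- con (+ 1)))
                  refl (v̂ t x) (fromℕ k) L M (M ^ k) ε (∣ x ∣)))
              where
              t<τ = 1+t+k≡τ⇒t<τ eq
              0≤LMᵏ : 0# ≤ L * M ^ k
              0≤LMᵏ = *-nonNeg 0≤L (^-nonNeg 0≤M k)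
              dominated : ∀ R → Grid ζ̲ ζ̄ ε R → v (suc t) (x * (1# + R)) ≤
                v̂ (suc t) (x * (1# + R)) + fromℕ k * (L * M ^ k * ε) * ∣ x ∣ * (M + R)
              dominated R R∈grid = ≤-by
                (+-nonNeg (x≤y⇒0≤y-x (next (x * (1# + R))))
                  (*-nonNeg (*-nonNeg (fromℕ-nonNeg k) (*-nonNeg 0≤LMᵏ 0≤ε)) (x≤y⇒0≤y-x scaled)))
                (solve 6 (λ V W B X X′ m → W :+ B :* X :* m :- V
                            := (W :+ B :* X′ :- V) :+ B :* (X :* m :- X′))
                  refl (v (suc t) (x * (1# + R))) (v̂ (suc t) (x * (1# + R)))
                  (fromℕ k * (L * M ^ k * ε)) (∣ x ∣) (∣ x * (1# + R) ∣) (M + R))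
                where
                scaled : ∣ x * (1# + R) ∣ ≤ ∣ x ∣ * (M + R)
                scaled = ≤-trans (∣x*y∣≤∣x∣*∣y∣ x (1# + R))
                  (*-monoˡ-≤ (0≤∣x∣ x) (expand R (grid⊆interval R R∈grid)))

  -- From an error linear in `ε` to the bound in its square root.

  -- The factor `1# + 1#` is there for large `ε`, where the a priori bounds on `v` and on `v̂` each
  -- contribute `L * M ^ τ * S₀`.
  errorBound : ∀ {ζ̲ ζ̄ M} → 0# < ζ̲ → 0# < ζ̄ → 1# ≤ M → Expansion (Interval ζ̲ ζ̄) M →
    ∀ τ → ErrorBound ((1# + 1#) * M ^ τ) ζ̲ ζ̄ τ
  errorBound {ζ̲} {ζ̄} {M} (0≤ζ̲ , _) (0≤ζ̄ , _) 1≤M expand τ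
    g L S₀ _ s v v̂ _ g0≡0 lip 0≤S₀ 0<ε (0≤s , refl) ev tv̂ =
      x≤y⇒0≤y-x (tree≤exact 0≤ζ̲ 0≤ζ̄ 0<ε tv tv̂ τ 0 refl S₀) , bound
    where
    tv = exact⇒tree ev
    0≤L = lipschitz-nonNeg lip
    lip≤ = lipschitz⇒lipschitzAbove lip
    ∣S₀∣≡S₀ = antisym (0≤x⇒∣x∣≤x 0≤S₀) (x≤∣x∣ S₀)
    Mτ = M ^ τ
    Q = Mτ * L * S₀
    0≤Q : 0# ≤ Q
    0≤Q = *-nonNeg (*-nonNeg (^-nonNeg (≤-trans 0≤1 1≤M) τ) 0≤L) 0≤S₀

    linear : v 0 S₀ ≤ v̂ 0 S₀ + fromℕ τ * (L * Mτ * (s * s)) * S₀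
    linear = subst (λ X → v 0 S₀ ≤ v̂ 0 S₀ + fromℕ τ * (L * Mτ * (s * s)) * X) ∣S₀∣≡S₀
      (exact≤tree+ε 0≤ζ̲ 0≤ζ̄ 0<ε tv tv̂ 1≤M expand 0≤L lip≤ τ 0 refl S₀)

    above : v 0 S₀ ≤ L * Mτ * S₀
    above = subst (λ X → v 0 S₀ ≤ L * Mτ * X) ∣S₀∣≡S₀
      (exact≤L∣x∣ 0≤ζ̲ 0≤ζ̄ 0<ε tv tv̂ 1≤M expand 0≤L lip≤ g0≡0 τ 0 refl S₀)

    below : 0# ≤ v̂ 0 S₀ + L * Mτ * S₀
    below = subst (λ X → 0# ≤ v̂ 0 S₀ + L * Mτ * X) ∣S₀∣≡S₀
      (0≤tree+L∣x∣ 0≤ζ̲ 0≤ζ̄ 0<ε tv tv̂ 1≤M expand 0≤L lip≤ g0≡0 τ 0 refl S₀)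

    large-step : 1# ≤ s → ∀ n → n ≡ τ → v 0 S₀ - v̂ 0 S₀ ≤ (1# + 1#) * Mτ * s * L * fromℕ n * S₀
    -- With no rounds the target bound is zero, too small for the a priori bounds, but the linear
    -- error vanishes as well.
    large-step 1≤s zero refl = ≤-by (x≤y⇒0≤y-x linear)
      (solve 6 (λ v w m s L S →
          (con (+ 1) :+ con (+ 1)) :* m :* s :* L :* con (+ 0) :* S :- (v :- w)
          := w :+ con (+ 0) :* (L :* m :* (s :* s)) :* S :- v)
        refl (v 0 S₀) (v̂ 0 S₀) Mτ s L S₀)
    -- With at least one round and `1# ≤ s`, the product of `s` and the number of rounds is at least
    -- `1#`; `0≤excess` is the slack.
    large-step 1≤s (suc n) _ = ≤-by
      (+-nonNeg (+-nonNeg (x≤y⇒0≤y-x above) (x≤y⇒0≤y-x below)) (+-nonNeg 0≤excess 0≤excess))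
      (solve 7 (λ v w m s L S N →
          (con (+ 1) :+ con (+ 1)) :* m :* s :* L :* (con (+ 1) :+ N) :* S :- (v :- w)
          := (L :* m :* S :- v) :+ (w :+ L :* m :* S :- con (+ 0))
             :+ (m :* L :* S :* (s :- con (+ 1) :+ s :* N) :+ m :* L :* S :* (s :- con (+ 1) :+ s :* N)))
        refl (v 0 S₀) (v̂ 0 S₀) Mτ s L S₀ (fromℕ n))
      where
      0≤excess : 0# ≤ Q * (s - 1# + s * fromℕ n)
      0≤excess = *-nonNeg 0≤Q (+-nonNeg (x≤y⇒0≤y-x 1≤s) (*-nonNeg 0≤s (fromℕ-nonNeg n)))

    -- The error is linear in ε = s², which is at most s when s ≤ 1; for s ≥ 1 the a priori
    -- bounds on both values suffice.
    bound : v 0 S₀ - v̂ 0 S₀ ≤ (1# + 1#) * Mτ * s * L * fromℕ τ * S₀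
    bound with total s 1#
    ... | inj₂ 1≤s = large-step 1≤s τ refl
    ... | inj₁ s≤1 = ≤-by
      (+-nonNeg (x≤y⇒0≤y-x linear)
        (*-nonNeg (*-nonNeg (*-nonNeg 0≤Q (fromℕ-nonNeg τ)) 0≤s) (+-nonNeg (x≤y⇒0≤y-x s≤1) 0≤1)))
      (solve 7 (λ v w m s L S T →
          (con (+ 1) :+ con (+ 1)) :* m :* s :* L :* T :* S :- (v :- w)
          := (w :+ T :* (L :* m :* (s :* s)) :* S :- v)
             :+ m :* L :* S :* T :* s :* (con (+ 1) :- s :+ con (+ 1)))
        refl (v 0 S₀) (v̂ 0 S₀) Mτ s L S₀ (fromℕ τ))

-- When `ζ̲τ ≤ 1#`, prices keep their sign and `M = 1#` gives an absolute constant. Otherwise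
-- `M ^ τ` enters, so `C₁` may depend on the return bounds and on `τ`, but it stays uniform in
-- payoff, initial price and `ε`.
theorem4p3 :
    (𝓡 : CompleteOrderedField) →
    let open CompleteOrderedField 𝓡
        open Hedging 𝓡 in
    (∃[ C₁ ]
       ((ζ̲ ζ̄ : List ℝ) (τ : ℕ) →
        let ζ̲τ = evalPoly ζ̲ (fromℕ τ)
            ζ̄τ = evalPoly ζ̄ (fromℕ τ) in
        0# < ζ̲τ → 0# < ζ̄τ → ζ̲τ ≤ 1# →
        ErrorBound C₁ ζ̲τ ζ̄τ τ))
    ×
    ((ζ̲ ζ̄ : List ℝ) (τ : ℕ) →
     let ζ̲τ = evalPoly ζ̲ (fromℕ τ)
         ζ̄τ = evalPoly ζ̄ (fromℕ τ) in
     0# < ζ̲τ → 0# < ζ̄τ →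
     ∃[ C₁ ] ErrorBound C₁ ζ̲τ ζ̄τ τ)
theorem4p3 𝓡 = (1# + 1# , λ ζ̲ ζ̄ τ → absolute τ) , λ ζ̲ ζ̄ τ → dependent τ
  where
  open CompleteOrderedField 𝓡
  open Hedging 𝓡
  open OrderedField 𝓡
  open ValueFunctions 𝓡

  absolute : ∀ {ζ̲ ζ̄} τ → 0# < ζ̲ → 0# < ζ̄ → ζ̲ ≤ 1# → ErrorBound (1# + 1#) ζ̲ ζ̄ τ
  absolute {ζ̲} {ζ̄} τ 0<ζ̲ 0<ζ̄ ζ̲≤1 = subst (λ C → ErrorBound C ζ̲ ζ̄ τ) 2*1^τ≡2
    (errorBound 0<ζ̲ 0<ζ̄ ≤-refl (interval-expansion ≤-refl 2ζ̲≤2) τ)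
    where
    2*1^τ≡2 : (1# + 1#) * 1# ^ τ ≡ 1# + 1#
    2*1^τ≡2 = trans (cong ((1# + 1#) *_) (1^n≡1 τ))
      (solve 1 (λ x → x :* con (+ 1) := x) refl (1# + 1#))
    2ζ̲≤2 : ζ̲ + ζ̲ ≤ 1# + 1#
    2ζ̲≤2 = ≤-by (+-nonNeg (x≤y⇒0≤y-x ζ̲≤1) (x≤y⇒0≤y-x ζ̲≤1))
      (solve 1 (λ z → con (+ 1) :+ con (+ 1) :- (z :+ z) := (con (+ 1) :- z) :+ (con (+ 1) :- z))
        refl ζ̲)

  dependent : ∀ {ζ̲ ζ̄} τ → 0# < ζ̲ → 0# < ζ̄ → ∃[ C₁ ] ErrorBound C₁ ζ̲ ζ̄ τ
  dependent {ζ̲} τ 0<ζ̲ 0<ζ̄ =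
    (1# + 1#) * M ^ τ , errorBound 0<ζ̲ 0<ζ̄ 1≤M (interval-expansion 1≤M 2ζ̲≤1+M) τ
    where
    -- The two conditions on `M` ask for at least the maximum of `1#` and `ζ̲ + ζ̲ - 1#`; this
    -- choice exceeds both without a case split.
    M = 1# + (ζ̲ + ζ̲)
    1≤M : 1# ≤ M
    1≤M = ≤-by (+-nonNeg (proj₁ 0<ζ̲) (proj₁ 0<ζ̲))
      (solve 1 (λ z → con (+ 1) :+ (z :+ z) :- con (+ 1) := z :+ z) refl ζ̲)
    2ζ̲≤1+M : ζ̲ + ζ̲ ≤ 1# + M
    2ζ̲≤1+M = ≤-by (+-nonNeg 0≤1 0≤1)
      (solve 1 (λ z → con (+ 1) :+ (con (+ 1) :+ (z :+ z)) :- (z :+ z) := con (+ 1) :+ con (+ 1))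
        refl ζ̲)
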